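{- For each positive integer $m$ let $\alpha_m = (2m, 2m-2, \ldots, 2)$, and let $\alpha_0$ be the empty partition. Suppose that either $n$ and $s$ are positive integers, or $s = k/2$ for some odd positive integer $k$ and $n$ is an odd positive integer. Then \[c^{s*\alpha_n}_{s*\alpha_{n-1},\, s*(n+1, n-1)} = \binom{n}{sn+s}_{2s} - \binom{n}{sn+s+1}_{2s},\] where $c^{\lambda}_{\mu,\nu}$ denotes the Littlewood-Richardson coefficient, $s*\lambda$ denotes the partition obtained by multiplying every part of $\lambda$ by $s$, and $\binom{n}{k}_{2s}$ denotes the $2s$-binomial coefficient.
   Context: $r$-binomial coefficients: for positive integers $n, r$ and an integer $k$ with $0\le k\le rn$, $\binom{n}{k}_r$ is the coefficient of $x^k$ in $(1+x+x^2+\cdots+x^r)^n$; for $k > rn$ one sets $\binom{n}{k}_r = 0$. Here $r = 2s$ is a positive integer. Stretching: for a partition $\lambda = (\lambda_1,\lambda_2,\ldots)$, $s*\lambda = (s\lambda_1, s\lambda_2, \ldots)$. Here $s$ may be a half-integer; under the hypotheses all the resulting parts are integers. Littlewood-Richardson coefficients: $c^{\lambda}_{\mu,\nu}$ is the multiplicity of $V^\lambda$ in $V^\mu\otimes V^\nu$, where $V^\mu, V^\nu, V^\lambda$ are irreducible polynomial representations of $GL(N)$ ($N$ at least the number of parts of each partition involved). Equivalently (Littlewood-Richardson rule), $c^{\lambda}_{\mu,\nu}$ is the number of semistandard fillings (weakly increasing along rows, strictly increasing down columns) of the skew shape $\lambda/\mu$ with content $\nu$ (exactly $\nu_i$ entries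 equal to $i$ for each $i$) such that the word obtained by reading the rows from top to bottom, each row from right to left, is a ballot word: in every initial segment, the number of $a$'s is at least the number of $b$'s whenever $a<b$. -}

module Defs where

open import Data.Bool.Base using (if_then_else_)
open import Data.Fin.Base as Fin using (Fin)
import Data.Fin.Properties as Fin
open import Data.List.Base
  using (List; []; _∷_; length; lookup; map; filter; zip; drop; reverse; concatMap;
         replicate; alignWith; inits; allFin; cartesianProductWith)
open import Data.List.Relation.Unary.All using (All; all?)
open import Data.List.Relation.Unary.Linked as Linked using (Linked; []; [-]; _∷_; linked?)
import Data.List.Relation.Unary.Linked.Properties as Linked
open import Data.Nat.Base
open import Data.Nat.DivMod using (_/_; /-monoˡ-≤)
open import Data.Nat.Properties
open import Data.Product.Base using (_×_; _,_; proj₂; ∃-syntax; uncurry)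
open import Data.These.Base using (fold)
open import Relation.Binary.PropositionalEquality using (_≡_)
open import Relation.Nullary.Decidable using (Dec; does; _×-dec_; _→-dec_)

Odd : ℕ → Set
Odd n = ∃[ m ] n ≡ 1 + 2 * m

-- Half-integers s ≥ 0, represented by the natural number 2s.
record HalfInteger : Set where
  constructor _/2
  field
    twice : ℕ

open HalfInteger public

fromℕ : ℕ → HalfInteger
fromℕ k = (2 * k) /2

-- The product s x. When it is not an integer this rounds down, so it is
-- meaningful only if 2 divides (2s) x; then 2 * (s · x) ≡ twice s * x by m*[n/m]≡n.
infixl 7 _·_
_·_ : HalfInteger → ℕ → ℕ
s · x = (twice s * x) / 2

-- Partitions; trailing zeros are allowed.
record Partition : Set where
  constructor mkPartition
  field
    parts      : List ℕ
    decreasing : Linked _≥_ parts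

open Partition public

infixr 7 _⋆_
_⋆_ : HalfInteger → Partition → Partition
s ⋆ μ = mkPartition (map (s ·_) (parts μ))
  (Linked.map⁺ (Linked.map (λ x≥y → /-monoˡ-≤ 2 (*-monoʳ-≤ (twice s) x≥y)) (decreasing μ)))

α : ℕ → Partition
α m = mkPartition (evens m) (evens-decreasing m)
  where
  evens : ℕ → List ℕ
  evens zero    = []
  evens (suc m) = 2 * suc m ∷ evens m

  evens-decreasing : ∀ m → Linked _≥_ (evens m)
  evens-decreasing 0             = []
  evens-decreasing 1             = [-]
  evens-decreasing (suc (suc m)) = *-monoʳ-≤ 2 (n≤1+n (suc m)) ∷ evens-decreasing (suc m)

β : ℕ → Partition
β n = mkPartition (n + 1 ∷ n ∸ 1 ∷ []) (≤-trans (m∸n≤m n 1) (m≤m+n n 1) ∷ [-])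

-- Row i of the skew shape ρ/μ as the pair (μᵢ , ρᵢ), missing parts being 0;
-- its cells are in the columns μᵢ + 1, …, ρᵢ.
skewRows : Partition → Partition → List (ℕ × ℕ)
skewRows ρ μ = alignWith (fold (λ m → m , 0) (λ l → 0 , l) _,_) (parts μ) (parts ρ)

Contained : List (ℕ × ℕ) → Set
Contained = All (uncurry _≤_)

-- The letters 1, …, k are represented by Fin k.
Word : ℕ → Set
Word k = List (Fin k)

-- A row is its number μᵢ of missing cells together with its entries, left to right.
Row : ℕ → Set
Row k = ℕ × Word k

Filling : ℕ → Set
Filling k = List (Row k)

words : ∀ k → ℕ → List (Word k)
words k zero    = [] ∷ []
words k (suc n) = cartesianProductWith _∷_ (allFin k) (words k n)

fillings : ∀ k → List (ℕ × ℕ) → List (Filling k)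
fillings k []             = [] ∷ []
fillings k ((m , l) ∷ rs) =
  cartesianProductWith _∷_ (map (m ,_) (words k (l ∸ m))) (fillings k rs)

RowWeak : ∀ {k} → Row k → Set
RowWeak (_ , u) = Linked Fin._≤_ u

-- For m' ≤ m, dropping m ∸ m' entries of the lower row aligns the columns;
-- zip then pairs the entries in the columns common to both rows.
Above : ∀ {k} → Row k → Row k → Set
Above (m , u) (m' , v) = All (uncurry Fin._<_) (zip u (drop (m ∸ m') v))

Semistandard : ∀ {k} → Filling k → Set
Semistandard t = All RowWeak t × Linked Above t

readingWord : ∀ {k} → Filling k → Word k
readingWord = concatMap (λ row → reverse (proj₂ row))

count : ∀ {k} → Fin k → Word k → ℕ
count a w = length (filter (Fin._≟ a) w)

HasContent : (ν : Partition) → Word (length (parts ν)) → Set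
HasContent ν w = ∀ i → count i w ≡ lookup (parts ν) i

Ballot : ∀ {k} → Word k → Set
Ballot w = All (λ u → ∀ a b → a Fin.< b → count a u ≥ count b u) (inits w)

IsLR : (ν : Partition) → Filling (length (parts ν)) → Set
IsLR ν t = Semistandard t × HasContent ν (readingWord t) × Ballot (readingWord t)

contained? : ∀ rs → Dec (Contained rs)
contained? = all? (λ (m , l) → m ≤? l)

semistandard? : ∀ {k} (t : Filling k) → Dec (Semistandard t)
semistandard? t =
  all? (λ (_ , u) → linked? Fin._≤?_ u) t ×-dec
  linked? (λ _ _ → all? (λ (a , b) → a Fin.<? b) _) t

hasContent? : ∀ ν w → Dec (HasContent ν w)
hasContent? ν w = Fin.all? (λ i → count i w ≟ lookup (parts ν) i)

ballot? : ∀ {k} (w : Word k) → Dec (Ballot w)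
ballot? w = all? (λ u → Fin.all? (λ a → Fin.all? (λ b →
  (a Fin.<? b) →-dec (count a u ≥? count b u)))) (inits w)

isLR? : ∀ ν t → Dec (IsLR ν t)
isLR? ν t = semistandard? t ×-dec hasContent? ν (readingWord t) ×-dec ballot? (readingWord t)

-- The coefficient with upper index ρ and lower indices μ, ν,
-- defined by the Littlewood–Richardson rule.
littlewoodRichardson : (ρ μ ν : Partition) → ℕ
littlewoodRichardson ρ μ ν =
  if does (contained? (skewRows ρ μ))
  then length (filter (isLR? ν) (fillings (length (parts ν)) (skewRows ρ μ)))
  else 0

-- Polynomials over ℕ as coefficient lists, constant term first.
Poly : Set
Poly = List ℕ

_⊕_ : Poly → Poly → Poly
p ⊕ q = alignWith (fold (λ a → a) (λ b → b) _+_) p q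

_⊗_ : Poly → Poly → Poly
[]      ⊗ q = []
(a ∷ p) ⊗ q = map (a *_) q ⊕ (0 ∷ (p ⊗ q))

pow : Poly → ℕ → Poly
pow p zero    = 1 ∷ []
pow p (suc n) = p ⊗ pow p n

coefficient : Poly → ℕ → ℕ
coefficient []      _       = 0
coefficient (a ∷ p) zero    = a
coefficient (a ∷ p) (suc k) = coefficient p k

-- binomial r n k is the coefficient of xᵏ in (1 + x + ⋯ + xʳ)ⁿ.
binomial : (r n k : ℕ) → ℕ
binomial r n k = coefficient (pow (replicate (suc r) 1) n) k

module Submission where

-- Write r = 2s. The skew shape consists of n rows of length r, no two of which
-- meet a common column, so a tableau is a choice of a sorted word 1ᵃ2ᵇ with
-- a + b = r in each row, subject to the ballot condition. The count G(n, d, k) of ways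
-- to add n rows containing k letters 1 in total, after rows with d more 1's than 2's, satisfies
--   G(n, d, k) = B(n, k) − B(n, k + d + 1)   whenever n r ≤ d + 2k,
-- where B(n, k) is the coefficient of xᵏ in (1 + ⋯ + xʳ)ⁿ. In the induction on n,
-- the summand for a row with a + b = r and b ≤ d is B(n, k − a) − B(n, k + d + 1 − b),
-- and the missing summands with b > d cancel in total since their arguments
-- k − a and k − (b − d − 1) run through the same values. The theorem is the case
-- d = 0, k = s(n + 1).

open import Defs
open import Data.Bool.Base using (true; false)
open import Data.Empty using (⊥-elim)
open import Data.Fin.Base as Fin using (Fin; zero; suc)
import Data.Fin.Properties as Fin
open import Data.List.Base hiding (sum)
open import Data.List.Membership.Propositional using (_∈_)
open import Data.List.Membership.Propositional.Properties using (∈-cartesianProductWith⁻; ∈-map⁻)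
open import Data.List.Properties
  using (length-++; length-reverse; reverse-++; map-id; map-cong; map-∘; ++-assoc; drop-all;
         zipWith-zeroʳ; map-++; unfold-reverse; filter-none; filter-++)
open import Data.List.Relation.Unary.All as All using (All; []; _∷_; all?)
import Data.List.Relation.Unary.All.Properties as All
open import Data.List.Relation.Unary.Any using (here; there)
open import Data.List.Relation.Unary.Linked as Linked using (Linked; []; [-]; _∷_; linked?)
open import Data.Nat.Base
open import Data.Nat.DivMod using (m*n/n≡m; /-congˡ)
open import Data.Nat.ListAction using (sum)
open import Data.Nat.ListAction.Properties using (sum-++)
open import Data.Nat.Properties
open import Data.Nat.Tactic.RingSolver using (solve-∀)
open import Data.Product.Base using (_×_; _,_; proj₂; ∃-syntax)
open import Data.Sum.Base using (_⊎_; inj₁; inj₂)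
open import Function.Base using (_∘_)
open import Function.Bundles using (_⇔_; mk⇔; Equivalence)
open import Level using (0ℓ)
open import Relation.Binary.PropositionalEquality
open import Relation.Nullary.Decidable using (Dec; yes; no; does; _×-dec_; dec-true)
open import Relation.Nullary.Negation using (¬_)
open import Relation.Unary using (Pred; Decidable)

open ≡-Reasoning

private variable
  A B C : Set

-- Sums over the pairs (a, b) of naturals with a + b = r.

sumSplits : ℕ → (ℕ → ℕ → ℕ) → ℕ
sumSplits zero    f = f 0 0
sumSplits (suc r) f = f 0 (suc r) + sumSplits r (λ a b → f (suc a) b)

sumSplits-cong : ∀ r {f g} → (∀ a b → a + b ≡ r → f a b ≡ g a b) → sumSplits r f ≡ sumSplits r g
sumSplits-cong zero    f≗g = f≗g 0 0 refl
sumSplits-cong (suc r) f≗g =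
  cong₂ _+_ (f≗g 0 (suc r) refl) (sumSplits-cong r (λ a b eq → f≗g (suc a) b (cong suc eq)))

sumSplits-zero : ∀ r {f} → (∀ a b → a + b ≡ r → f a b ≡ 0) → sumSplits r f ≡ 0
sumSplits-zero zero    f≗0 = f≗0 0 0 refl
sumSplits-zero (suc r) f≗0 =
  cong₂ _+_ (f≗0 0 (suc r) refl) (sumSplits-zero r (λ a b eq → f≗0 (suc a) b (cong suc eq)))

sumSplits-+ : ∀ r {f g} →
  sumSplits r f + sumSplits r g ≡ sumSplits r (λ a b → f a b + g a b)
sumSplits-+ zero            = refl
sumSplits-+ (suc r) {f} {g} = begin
  (f 0 (suc r) + F) + (g 0 (suc r) + G)  ≡⟨ interchange (f 0 (suc r)) F (g 0 (suc r)) G ⟩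
  (f 0 (suc r) + g 0 (suc r)) + (F + G)  ≡⟨ cong₂ _+_ refl (sumSplits-+ r) ⟩
  sumSplits (suc r) (λ a b → f a b + g a b) ∎
  where
  F = sumSplits r (λ a b → f (suc a) b)
  G = sumSplits r (λ a b → g (suc a) b)
  interchange : ∀ w x y z → (w + x) + (y + z) ≡ (w + y) + (x + z)
  interchange = solve-∀

-- Separates the terms whose second argument exceeds `d` (first sum) from the others (second sum);
-- in each sum the indices are counted afresh from 0.
sumSplits-split : ∀ c d f →
  sumSplits (c + suc d) f
    ≡ sumSplits c (λ a b → f a (b + suc d)) + sumSplits d (λ a b → f (suc c + a) b)
sumSplits-split zero    d f = refl
sumSplits-split (suc c) d f =
  trans (cong₂ _+_ refl (sumSplits-split c d (λ a b → f (suc a) b))) (sym (+-assoc (f 0 _) _ _))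

sumSplits-snoc : ∀ r f →
  sumSplits (suc r) f ≡ sumSplits r (λ a b → f a (suc b)) + f (suc r) 0
sumSplits-snoc zero    f = refl
sumSplits-snoc (suc r) f =
  trans (cong (f 0 (suc (suc r)) +_) (sumSplits-snoc r (λ a b → f (suc a) b))) (sym (+-assoc (f 0 _) _ _))

sumSplits-swap : ∀ r f → sumSplits r f ≡ sumSplits r (λ a b → f b a)
sumSplits-swap zero    f = refl
sumSplits-swap (suc r) f = begin
  f 0 (suc r) + sumSplits r (λ a b → f (suc a) b)  ≡⟨ +-comm (f 0 (suc r)) _ ⟩
  sumSplits r (λ a b → f (suc a) b) + f 0 (suc r)  ≡⟨ cong₂ _+_ (sumSplits-swap r _) refl ⟩
  sumSplits r (λ a b → f (suc b) a) + f 0 (suc r)  ≡⟨ sumSplits-snoc r (λ a b → f b a) ⟨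
  sumSplits (suc r) (λ a b → f b a)                ∎

-- Coefficients of the powers of 1 + x + ⋯ + xʳ.

-- Multiplication by xᵃ.
shift : ℕ → Poly → Poly
shift a p = replicate a 0 ++ p

coefficient-shift : ∀ a p k → coefficient (shift a p) (a + k) ≡ coefficient p k
coefficient-shift zero    p k = refl
coefficient-shift (suc a) p k = coefficient-shift a p k

coefficient-shift-< : ∀ a p k → k < a → coefficient (shift a p) k ≡ 0
coefficient-shift-< (suc a) p zero    _         = refl
coefficient-shift-< (suc a) p (suc k) (s≤s k<a) = coefficient-shift-< a p k k<a

coefficient-shift-> : ∀ a p m → (∀ k → m < k → coefficient p k ≡ 0) →
  ∀ k → a + m < k → coefficient (shift a p) k ≡ 0
coefficient-shift-> zero    p m p-deg k       m<k         = p-deg k m<k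
coefficient-shift-> (suc a) p m p-deg (suc k) (s≤s a+m<k) = coefficient-shift-> a p m p-deg k a+m<k

coefficient-⊕ : ∀ p q k → coefficient (p ⊕ q) k ≡ coefficient p k + coefficient q k
coefficient-⊕ []      q       k       = cong (λ p → coefficient p k) (map-id q)
coefficient-⊕ (a ∷ p) []      k       =
  trans (cong (λ p → coefficient p k) (map-id (a ∷ p))) (sym (+-identityʳ _))
coefficient-⊕ (a ∷ p) (b ∷ q) zero    = refl
coefficient-⊕ (a ∷ p) (b ∷ q) (suc k) = coefficient-⊕ p q k

coefficient-1∷-⊗ : ∀ p q k →
  coefficient ((1 ∷ p) ⊗ q) k ≡ coefficient q k + coefficient (0 ∷ (p ⊗ q)) k
coefficient-1∷-⊗ p q k = begin
  coefficient (map (1 *_) q ⊕ (0 ∷ (p ⊗ q))) k                 ≡⟨ coefficient-⊕ (map (1 *_) q) _ k ⟩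
  coefficient (map (1 *_) q) k + coefficient (0 ∷ (p ⊗ q)) k
    ≡⟨ cong (λ q′ → coefficient q′ k + coefficient (0 ∷ (p ⊗ q)) k)
            (trans (map-cong *-identityˡ q) (map-id q)) ⟩
  coefficient q k + coefficient (0 ∷ (p ⊗ q)) k                ∎

-- Induction through 1 + ⋯ + xʳ⁺¹ = 1 + x (1 + ⋯ + xʳ): the constant term gives the summand a = 0,
-- and the factor x raises every other shift by one.
coefficient-replicate-⊗ : ∀ r q k →
  coefficient (replicate (suc r) 1 ⊗ q) k ≡ sumSplits r (λ a _ → coefficient (shift a q) k)
coefficient-replicate-⊗ zero q k =
  trans (coefficient-1∷-⊗ [] q k) (trans (cong₂ _+_ refl (coefficient-0 k)) (+-identityʳ _))
  where
  coefficient-0 : ∀ k → coefficient (0 ∷ []) k ≡ 0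
  coefficient-0 zero    = refl
  coefficient-0 (suc k) = refl
coefficient-replicate-⊗ (suc r) q k =
  trans (coefficient-1∷-⊗ (replicate (suc r) 1) q k) (cong₂ _+_ refl (shifted k))
  where
  shifted : ∀ k → coefficient (0 ∷ (replicate (suc r) 1 ⊗ q)) k
    ≡ sumSplits r (λ a _ → coefficient (shift (suc a) q) k)
  shifted zero    = sym (sumSplits-zero r (λ _ _ _ → refl))
  shifted (suc k) = coefficient-replicate-⊗ r q k

binomial-suc : ∀ r n k →
  binomial r (suc n) k ≡ sumSplits r (λ a _ → coefficient (shift a (pow (replicate (suc r) 1) n)) k)
binomial-suc r n k = coefficient-replicate-⊗ r _ k

-- The polynomial has degree at most n r, since each factor raises the degree by at most r.
binomial-> : ∀ r n k → n * r < k → binomial r n k ≡ 0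
binomial-> r zero    (suc k) _    = refl
binomial-> r (suc n) k       nr<k = trans (binomial-suc r n k) (sumSplits-zero r λ a b a+b≡r →
  coefficient-shift-> a _ (n * r) (binomial-> r n) k
    (≤-<-trans (+-monoˡ-≤ (n * r) (subst (a ≤_) a+b≡r (m≤m+n a b))) nr<k))

-- Counting the members of a list that satisfy a predicate.

tally : {P : Pred A 0ℓ} → Decidable P → List A → ℕ
tally P? xs = length (filter P? xs)

-- The equivalence is asked for members only, because row lengths are known only for fillings that
-- occur in the enumeration.
tally-cong : {P Q : Pred A 0ℓ} (P? : Decidable P) (Q? : Decidable Q) → ∀ xs →
  (∀ {x} → x ∈ xs → P x ⇔ Q x) → tally P? xs ≡ tally Q? xs
tally-cong P? Q? []       P⇔Q = refl
tally-cong P? Q? (x ∷ xs) P⇔Q with P? x | Q? x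
... | yes p | yes q = cong suc (tally-cong P? Q? xs (P⇔Q ∘ there))
... | no ¬p | no ¬q = tally-cong P? Q? xs (P⇔Q ∘ there)
... | yes p | no ¬q = ⊥-elim (¬q (Equivalence.to (P⇔Q (here refl)) p))
... | no ¬p | yes q = ⊥-elim (¬p (Equivalence.from (P⇔Q (here refl)) q))

tally-none : {P : Pred A 0ℓ} (P? : Decidable P) → ∀ xs → (∀ x → ¬ P x) → tally P? xs ≡ 0
tally-none P? xs ¬P = cong length (filter-none P? (All.universal ¬P xs))

tally-map : {P : Pred B 0ℓ} (P? : Decidable P) (f : A → B) → ∀ xs →
  tally P? (map f xs) ≡ tally (λ x → P? (f x)) xs
tally-map P? f []       = refl
tally-map P? f (x ∷ xs) with does (P? (f x))
... | true  = cong suc (tally-map P? f xs)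
... | false = tally-map P? f xs

tally-cartesianProductWith : {P : Pred C 0ℓ} (P? : Decidable P) (f : A → B → C) → ∀ xs ys →
  tally P? (cartesianProductWith f xs ys) ≡ sum (map (λ x → tally (λ y → P? (f x y)) ys) xs)
tally-cartesianProductWith P? f []       ys = refl
tally-cartesianProductWith P? f (x ∷ xs) ys = begin
  tally P? (map (f x) ys ++ rest)           ≡⟨ cong length (filter-++ P? (map (f x) ys) rest) ⟩
  length (filter P? (map (f x) ys) ++ _)    ≡⟨ length-++ (filter P? (map (f x) ys)) ⟩
  tally P? (map (f x) ys) + tally P? rest
    ≡⟨ cong₂ _+_ (tally-map P? (f x) ys) (tally-cartesianProductWith P? f xs ys) ⟩
  sum (map (λ x → tally (λ y → P? (f x y)) ys) (x ∷ xs)) ∎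
  where rest = cartesianProductWith f xs ys

-- Sums over words in two letters.

pattern one = zero
pattern two = suc zero

sortedWord : ℕ → ℕ → Word 2
sortedWord a b = replicate a one ++ replicate b two

-- This lets a sum over all words of length r collapse to the r + 1 sorted ones.
VanishesOffSorted : (Word 2 → ℕ) → Set
VanishesOffSorted g = ∀ u → ¬ Linked Fin._≤_ u → g u ≡ 0

vanishes-∷ : ∀ i {g} → VanishesOffSorted g → VanishesOffSorted (λ u → g (i ∷ u))
vanishes-∷ i g-off u unsorted = g-off (i ∷ u) (unsorted ∘ Linked.tail)

sum-words-suc : ∀ r (g : Word 2 → ℕ) →
  sum (map g (words 2 (suc r)))
    ≡ sum (map (λ u → g (one ∷ u)) (words 2 r)) + sum (map (λ u → g (two ∷ u)) (words 2 r))
sum-words-suc r g = begin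
  sum (map g (map (one ∷_) W ++ (map (two ∷_) W ++ [])))    ≡⟨ sum-map-++ (map (one ∷_) W) _ ⟩
  sum (map g (map (one ∷_) W)) + sum (map g (map (two ∷_) W ++ []))
    ≡⟨ cong₂ _+_ refl (trans (sum-map-++ (map (two ∷_) W) []) (+-identityʳ _)) ⟩
  sum (map g (map (one ∷_) W)) + sum (map g (map (two ∷_) W))
    ≡⟨ cong₂ _+_ (cong sum (map-∘ W)) (cong sum (map-∘ W)) ⟨
  sum (map (λ u → g (one ∷ u)) W) + sum (map (λ u → g (two ∷ u)) W) ∎
  where
  W = words 2 r
  sum-map-++ : ∀ us vs → sum (map g (us ++ vs)) ≡ sum (map g us) + sum (map g vs)
  sum-map-++ us vs = trans (cong sum (map-++ g us vs)) (sum-++ (map g us) (map g vs))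

sum-words-two : ∀ r g → VanishesOffSorted g →
  sum (map (λ u → g (two ∷ u)) (words 2 r)) ≡ g (replicate (suc r) two)
sum-words-two zero    g g-off = +-identityʳ _
sum-words-two (suc r) g g-off = begin
  sum (map (λ u → g (two ∷ u)) (words 2 (suc r)))       ≡⟨ sum-words-suc r _ ⟩
  sum (map (λ u → g (two ∷ one ∷ u)) (words 2 r)) + _
    -- A 1 directly after the leading 2 is a descent, so these words contribute nothing.
    ≡⟨ cong₂ _+_ (sum-zero (words 2 r) (λ u → g-off _ λ { (() ∷ _) })) refl ⟩
  sum (map (λ u → g (two ∷ two ∷ u)) (words 2 r))
    ≡⟨ sum-words-two r _ (vanishes-∷ two g-off) ⟩
  g (replicate (suc (suc r)) two)                       ∎
  where
  sum-zero : ∀ (us : List (Word 2)) {f} → (∀ u → f u ≡ 0) → sum (map f us) ≡ 0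
  sum-zero []       f≗0 = refl
  sum-zero (u ∷ us) f≗0 = cong₂ _+_ (f≗0 u) (sum-zero us f≗0)

-- A leading 1 leaves a shorter sorted word, giving the splits with a > 0; a leading 2 forces 2's
-- throughout, giving the split a = 0.
sum-words : ∀ r g → VanishesOffSorted g →
  sum (map g (words 2 r)) ≡ sumSplits r (λ a b → g (sortedWord a b))
sum-words zero    g g-off = +-identityʳ _
sum-words (suc r) g g-off = begin
  sum (map g (words 2 (suc r)))  ≡⟨ sum-words-suc r g ⟩
  sum (map (λ u → g (one ∷ u)) (words 2 r)) + sum (map (λ u → g (two ∷ u)) (words 2 r))
    ≡⟨ cong₂ _+_ (sum-words r _ (vanishes-∷ one g-off)) (sum-words-two r g g-off) ⟩
  sumSplits r (λ a b → g (sortedWord (suc a) b)) + g (sortedWord 0 (suc r))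
    ≡⟨ +-comm _ (g (sortedWord 0 (suc r))) ⟩
  sumSplits (suc r) (λ a b → g (sortedWord a b)) ∎

-- The ballot condition as a lead of 1's over 2's.

-- The ballot condition for w when it is read after a word with d more 1's than 2's.
BallotFrom : ℕ → Word 2 → Set
BallotFrom d w = All (λ u → count two u ≤ d + count one u) (inits w)

ballotFrom-one : ∀ d w → BallotFrom d (one ∷ w) ⇔ BallotFrom (suc d) w
ballotFrom-one d w = mk⇔
  (λ { (_ ∷ ps) → All.map (λ {u} → subst (count two u ≤_) (+-suc d _)) (All.map⁻ {xs = inits w} ps) })
  (λ ps → z≤n ∷ All.map⁺ {xs = inits w} (All.map (λ {u} → subst (count two u ≤_) (sym (+-suc d _))) ps))

ballotFrom-two : ∀ d w → BallotFrom (suc d) (two ∷ w) ⇔ BallotFrom d w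
ballotFrom-two d w = mk⇔
  (λ { (_ ∷ ps) → All.map s≤s⁻¹ (All.map⁻ {xs = inits w} ps) })
  (λ ps → z≤n ∷ All.map⁺ {xs = inits w} (All.map s≤s ps))

ballotFrom-ones : ∀ a d w → BallotFrom d (replicate a one ++ w) ⇔ BallotFrom (a + d) w
ballotFrom-ones zero    d w = mk⇔ (λ p → p) (λ p → p)
ballotFrom-ones (suc a) d w = mk⇔
  (λ p → subst (λ e → BallotFrom e w) (+-suc a d) (to IH (to (ballotFrom-one d _) p)))
  (λ p → from (ballotFrom-one d _) (from IH (subst (λ e → BallotFrom e w) (sym (+-suc a d)) p)))
  where
  open Equivalence
  IH = ballotFrom-ones a (suc d) w

ballotFrom-twos : ∀ b d w → BallotFrom (b + d) (replicate b two ++ w) ⇔ BallotFrom d w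
ballotFrom-twos zero    d w = mk⇔ (λ p → p) (λ p → p)
ballotFrom-twos (suc b) d w = mk⇔
  (λ p → to IH (to (ballotFrom-two (b + d) _) p))
  (λ p → from (ballotFrom-two (b + d) _) (from IH p))
  where
  open Equivalence
  IH = ballotFrom-twos b d w

ballotFrom-twos-≤ : ∀ b d w → BallotFrom d (replicate b two ++ w) → b ≤ d
ballotFrom-twos-≤ zero    d       w _            = z≤n
-- With no lead, the initial segment consisting of a single 2 already violates the condition.
ballotFrom-twos-≤ (suc b) zero    w (_ ∷ () ∷ _)
ballotFrom-twos-≤ (suc b) (suc d) w p            =
  s≤s (ballotFrom-twos-≤ b d w (Equivalence.to (ballotFrom-two d _) p))

count-twos-ones : ∀ b a (w : Word 2) →
  count one (replicate b two ++ (replicate a one ++ w)) ≡ a + count one w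
count-twos-ones (suc b) a       w = count-twos-ones b a w
count-twos-ones zero    zero    w = refl
count-twos-ones zero    (suc a) w = cong suc (count-twos-ones zero a w)

count-one+two : ∀ (w : Word 2) → count one w + count two w ≡ length w
count-one+two []        = refl
count-one+two (one ∷ w) = cong suc (count-one+two w)
count-one+two (two ∷ w) = trans (+-suc _ _) (cong suc (count-one+two w))

-- With two letters, 1 < 2 is the only strict comparison.
ballot⇔ballotFrom : ∀ w → Ballot w ⇔ BallotFrom 0 w
ballot⇔ballotFrom w = mk⇔
  (All.map (λ p → p one two (s≤s z≤n)))
  (All.map λ where
    p one two _       → p
    p one one ()
    p two one ()
    p two two (s≤s ()))

reverse-replicate : ∀ n (x : A) → reverse (replicate n x) ≡ replicate n x
reverse-replicate zero    x = refl
reverse-replicate (suc n) x = begin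
  reverse (x ∷ replicate n x)           ≡⟨ unfold-reverse x (replicate n x) ⟩
  reverse (replicate n x) ∷ʳ x          ≡⟨ cong (_∷ʳ x) (reverse-replicate n x) ⟩
  replicate n x ∷ʳ x                    ≡⟨ snoc n ⟩
  x ∷ replicate n x                     ∎
  where
  snoc : ∀ n → replicate n x ∷ʳ x ≡ x ∷ replicate n x
  snoc zero    = refl
  snoc (suc n) = cong (x ∷_) (snoc n)

sorted-linked : ∀ a b → Linked Fin._≤_ (sortedWord a b)
sorted-linked zero          zero          = []
sorted-linked zero          (suc zero)    = [-]
sorted-linked zero          (suc (suc b)) = s≤s z≤n ∷ sorted-linked zero (suc b)
sorted-linked (suc zero)    zero          = [-]
sorted-linked (suc zero)    (suc b)       = z≤n ∷ sorted-linked zero (suc b)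
sorted-linked (suc (suc a)) b             = z≤n ∷ sorted-linked (suc a) b

-- Fillings of the staircase shape, row by row.

-- Rows that may continue a filling with d more 1's than 2's and supply k further 1's.
Continues : ℕ → ℕ → Filling 2 → Set
Continues d k t = All RowWeak t × BallotFrom d (readingWord t) × count one (readingWord t) ≡ k

continues? : ∀ d k → Decidable (Continues d k)
continues? d k t =
  all? (λ (_ , u) → linked? Fin._≤?_ u) t ×-dec
  all? (λ u → count two u ≤? d + count one u) (inits (readingWord t)) ×-dec
  (count one (readingWord t) ≟ k)

-- Rows are read from right to left, so the 2's of a sorted row come first; the lead drops by b
-- before it rises by a.
readingWord-sorted : ∀ m a b t →
  readingWord ((m , sortedWord a b) ∷ t) ≡ replicate b two ++ (replicate a one ++ readingWord t)
readingWord-sorted m a b t = begin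
  reverse (sortedWord a b) ++ w                    ≡⟨ cong (_++ w) (reverse-++ (replicate a one) _) ⟩
  (reverse (replicate b two) ++ reverse (replicate a one)) ++ w
    ≡⟨ cong (_++ w) (cong₂ _++_ (reverse-replicate b two) (reverse-replicate a one)) ⟩
  (replicate b two ++ replicate a one) ++ w        ≡⟨ ++-assoc (replicate b two) _ _ ⟩
  replicate b two ++ (replicate a one ++ w)        ∎
  where w = readingWord t

-- The lead passes from b + d through d to a + d, while a of the required 1's are used up. The
-- additive form of the indices avoids truncated subtraction.
continues-sorted : ∀ m a b d k t →
  Continues (b + d) (a + k) ((m , sortedWord a b) ∷ t) ⇔ Continues (a + d) k t
continues-sorted m a b d k t rewrite readingWord-sorted m a b t = mk⇔
  (λ { (_ ∷ weak , ballot , ones) →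
    weak ,
    to (ballotFrom-ones a d w) (to (ballotFrom-twos b d _) ballot) ,
    +-cancelˡ-≡ a _ _ (trans (sym (count-twos-ones b a w)) ones) })
  (λ { (weak , ballot , ones) →
    sorted-linked a b ∷ weak ,
    from (ballotFrom-twos b d _) (from (ballotFrom-ones a d w) ballot) ,
    trans (count-twos-ones b a w) (cong (a +_) ones) })
  where
  open Equivalence
  w = readingWord t

continues-sorted-≤ : ∀ m a b d k t → Continues d k ((m , sortedWord a b) ∷ t) → b ≤ d × a ≤ k
continues-sorted-≤ m a b d k t rewrite readingWord-sorted m a b t = λ (_ , ballot , ones) →
  ballotFrom-twos-≤ b d _ ballot ,
  subst (a ≤_) (trans (sym (count-twos-ones b a (readingWord t))) ones) (m≤m+n a _)

-- The rows, top row first, of the skew shape of s ⋆ αₙ over s ⋆ αₙ₋₁ with r = 2s, written without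
-- halving.
stairs : ℕ → ℕ → List (ℕ × ℕ)
stairs r n = map (λ i → r * i , r * suc i) (downFrom n)

step-length : ∀ r n → r * suc n ∸ r * n ≡ r
step-length r n = trans (cong (_∸ r * n) (*-suc r n)) (m+n∸n≡m r (r * n))

continuations : (r n d k : ℕ) → ℕ
continuations r n d k = tally (continues? d k) (fillings 2 (stairs r n))

continuationsAfter : (r n d k : ℕ) → Word 2 → ℕ
continuationsAfter r n d k u =
  tally (λ t → continues? d k ((r * n , u) ∷ t)) (fillings 2 (stairs r n))

continuations-suc : ∀ r n d k →
  continuations r (suc n) d k ≡ sumSplits r (λ a b → continuationsAfter r n d k (sortedWord a b))
continuations-suc r n d k = begin
  continuations r (suc n) d k
    ≡⟨ tally-cartesianProductWith (continues? d k) _∷_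
         (map (r * n ,_) (words 2 (r * suc n ∸ r * n))) (fillings 2 (stairs r n)) ⟩
  sum (map afterRow (map (r * n ,_) (words 2 (r * suc n ∸ r * n))))
    ≡⟨ cong sum (map-∘ (words 2 (r * suc n ∸ r * n))) ⟨
  sum (map after (words 2 (r * suc n ∸ r * n)))
    ≡⟨ cong (λ l → sum (map after (words 2 l))) (step-length r n) ⟩
  sum (map after (words 2 r))
    -- No filling whose top row is unsorted is counted.
    ≡⟨ sum-words r after (λ u unsorted →
         tally-none _ (fillings 2 (stairs r n)) (λ { t (sorted ∷ _ , _) → unsorted sorted })) ⟩
  sumSplits r (λ a b → after (sortedWord a b)) ∎
  where
  after = continuationsAfter r n d k
  afterRow : Row 2 → ℕ
  afterRow row = tally (λ t → continues? d k (row ∷ t)) (fillings 2 (stairs r n))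

-- The hypothesis says that the final lead d + k - (n r - k) is nonnegative. Adding a row leaves
-- that final lead unchanged, so the hypothesis passes to the remaining rows. The difference of
-- coefficients is stated additively to stay in ℕ.
continuations-formula : ∀ r n d k → n * r ≤ d + (k + k) →
  continuations r n d k + binomial r n (k + suc d) ≡ binomial r n k
continuations-formula r zero    d zero    _    = refl
continuations-formula r zero    d (suc k) _    = refl
continuations-formula r (suc n) d k       nr≤e = begin
  continuations r (suc n) d k + binomial r (suc n) (k + suc d)
    ≡⟨ cong₂ _+_ (continuations-suc r n d k) (binomial-suc r n (k + suc d)) ⟩
  sumSplits r F + sumSplits r (λ a _ → X a (k + suc d))  ≡⟨ telescope (r ≤? d) ⟩
  sumSplits r (λ a _ → X a k)                            ≡⟨ binomial-suc r n k ⟨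
  binomial r (suc n) k                                   ∎
  where
  X : ℕ → ℕ → ℕ
  X a = coefficient (shift a (pow (replicate (suc r) 1) n))

  F : ℕ → ℕ → ℕ
  F a b = continuationsAfter r n d k (sortedWord a b)

  F-zero : ∀ a b → ¬ (b ≤ d × a ≤ k) → F a b ≡ 0
  F-zero a b ¬≤ = tally-none _ (fillings 2 (stairs r n))
    (λ t c → ¬≤ (continues-sorted-≤ (r * n) a b d k t c))

  bound : ∀ a b d′ k′ → a + b ≡ r → b + d′ ≡ d → a + k′ ≡ k → n * r ≤ (a + d′) + (k′ + k′)
  bound a b d′ k′ refl refl refl =
    +-cancelˡ-≤ (a + b) _ _ (subst ((a + b) + n * r ≤_) (regroup a b d′ k′) nr≤e)
    where
    regroup : ∀ a b d k → (b + d) + ((a + k) + (a + k)) ≡ (a + b) + ((a + d) + (k + k))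
    regroup = solve-∀

  F-term : ∀ a b → a + b ≡ r → b ≤ d → F a b + X b (k + suc d) ≡ X a k
  F-term a b a+b≡r b≤d with a ≤? k
  ... | no a≰k = begin
    F a b + X b (k + suc d)  ≡⟨ cong₂ _+_ (F-zero a b (a≰k ∘ proj₂)) X-zero ⟩
    0                        ≡⟨ coefficient-shift-< a _ k (≰⇒> a≰k) ⟨
    X a k                    ∎
    where
    regroup : ∀ a b c → b + c + a ≡ a + b + c
    regroup = solve-∀
    regroup′ : ∀ d k → d + (k + k) ≡ k + d + k
    regroup′ = solve-∀
    X-zero : X b (k + suc d) ≡ 0
    -- Since k < a, the bound a + b + n r ≤ d + 2k gives b + n r ≤ k + d, so the index k + d + 1
    -- lies above the degree.
    X-zero = coefficient-shift-> b _ (n * r) (binomial-> r n) (k + suc d)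
      (subst (b + n * r <_) (sym (+-suc k d)) (s≤s (+-cancelʳ-≤ a _ _ (≤-trans
        (≤-trans (≤-reflexive (trans (regroup a b (n * r)) (cong (_+ n * r) a+b≡r))) nr≤e)
        (≤-trans (≤-reflexive (regroup′ d k)) (+-monoʳ-≤ (k + d) (<⇒≤ (≰⇒> a≰k))))))))
  ... | yes a≤k with m≤n⇒∃[o]m+o≡n b≤d | m≤n⇒∃[o]m+o≡n a≤k
  ... | d′ , b+d′≡d | k′ , a+k′≡k = begin
    F a b + X b (k + suc d)
      -- With d = b + d′ and k = a + k′, taking b away from k + d + 1 leaves k′ + (a + d′) + 1, the
      -- second index in the induction hypothesis for lead a + d′.
      ≡⟨ cong₂ _+_ F-rec (cong (X b) (index a b d′ k′ b+d′≡d a+k′≡k)) ⟩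
    continuations r n (a + d′) k′ + X b (b + (k′ + suc (a + d′)))
      ≡⟨ cong₂ _+_ refl (coefficient-shift b _ (k′ + suc (a + d′))) ⟩
    continuations r n (a + d′) k′ + binomial r n (k′ + suc (a + d′))
      ≡⟨ continuations-formula r n (a + d′) k′ (bound a b d′ k′ a+b≡r b+d′≡d a+k′≡k) ⟩
    binomial r n k′
      ≡⟨ coefficient-shift a _ k′ ⟨
    X a (a + k′)
      ≡⟨ cong (X a) a+k′≡k ⟩
    X a k ∎
    where
    index : ∀ a b d′ k′ → b + d′ ≡ d → a + k′ ≡ k → k + suc d ≡ b + (k′ + suc (a + d′))
    index a b d′ k′ refl refl = regroup a b d′ k′
      where
      regroup : ∀ a b d k → a + k + (1 + (b + d)) ≡ b + (k + (1 + (a + d)))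
      regroup = solve-∀
    F-rec : F a b ≡ continuations r n (a + d′) k′
    F-rec = tally-cong _ (continues? (a + d′) k′) (fillings 2 (stairs r n)) λ {t} _ →
      subst₂ (λ d k → Continues d k ((r * n , sortedWord a b) ∷ t) ⇔ Continues (a + d′) k′ t)
        b+d′≡d a+k′≡k (continues-sorted (r * n) a b d′ k′ t)

  telescope : Dec (r ≤ d) →
    sumSplits r F + sumSplits r (λ a _ → X a (k + suc d)) ≡ sumSplits r (λ a _ → X a k)
  telescope (yes r≤d) = begin
    sumSplits r F + sumSplits r (λ a _ → X a (k + suc d))
      -- Reversing the second sum pairs `F a b` with the shift by b, as `F-term` requires.
      ≡⟨ cong₂ _+_ refl (sumSplits-swap r _) ⟩
    sumSplits r F + sumSplits r (λ _ b → X b (k + suc d))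
      ≡⟨ sumSplits-+ r ⟩
    sumSplits r (λ a b → F a b + X b (k + suc d))
      ≡⟨ sumSplits-cong r (λ a b a+b≡r →
           F-term a b a+b≡r (≤-trans (subst (b ≤_) a+b≡r (m≤n+m b a)) r≤d)) ⟩
    sumSplits r (λ a _ → X a k) ∎
  -- Writing r = c + (d + 1), the rows with more than d letters 2 are those with a ≤ c.
  telescope (no r≰d) with m≤n⇒∃[o]m+o≡n (≰⇒> r≰d)
  ... | c , d+c≡r = subst
    (λ m → sumSplits m F + sumSplits m (λ a _ → X a (k + suc d)) ≡ sumSplits m (λ a _ → X a k))
    c+d≡r (begin
    sumSplits (c + suc d) F + sumSplits (c + suc d) (λ a _ → X a (k + suc d))
      ≡⟨ cong₂ _+_ refl (sumSplits-swap (c + suc d) _) ⟩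
    sumSplits (c + suc d) F + sumSplits (c + suc d) (λ _ b → X b (k + suc d))
      ≡⟨ sumSplits-+ (c + suc d) ⟩
    sumSplits (c + suc d) (λ a b → F a b + X b (k + suc d))
      ≡⟨ sumSplits-split c d _ ⟩
    sumSplits c (λ a b → F a (b + suc d) + X (b + suc d) (k + suc d))
      + sumSplits d (λ a b → F (suc c + a) b + X b (k + suc d))
      ≡⟨ cong₂ _+_ (sumSplits-cong c (λ a b _ → outside a b)) (sumSplits-cong d inside) ⟩
    sumSplits c (λ _ b → X b k) + sumSplits d (λ a _ → X (suc c + a) k)
      -- The leftover terms `X b k` run over b = 0, ..., c, the very indices missing from the other
      -- sum, so the two sums join.
      ≡⟨ cong₂ _+_ (sumSplits-swap c _) refl ⟩
    sumSplits c (λ a _ → X a k) + sumSplits d (λ a _ → X (suc c + a) k)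
      ≡⟨ sumSplits-split c d _ ⟨
    sumSplits (c + suc d) (λ a _ → X a k) ∎)
    where
    c+d≡r : c + suc d ≡ r
    c+d≡r = trans (+-comm c (suc d)) d+c≡r

    -- The common factor x to the power d + 1 is stripped zero by zero, which requires no comparison
    -- of b with k.
    shift-+ : ∀ b p → coefficient (shift (b + suc d) p) (k + suc d) ≡ coefficient (shift b p) k
    shift-+ b p = begin
      coefficient (replicate (b + suc d) 0 ++ p) (k + suc d)
        ≡⟨ cong₂ (λ m → coefficient (replicate m 0 ++ p)) (+-comm b (suc d)) (+-comm k (suc d)) ⟩
      coefficient (replicate (suc d + b) 0 ++ p) (suc d + k)  ≡⟨ drop-shift (suc d) ⟩
      coefficient (replicate b 0 ++ p) k                      ∎
      where
      drop-shift : ∀ e → coefficient (replicate (e + b) 0 ++ p) (e + k) ≡ coefficient (replicate b 0 ++ p) k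
      drop-shift zero    = refl
      drop-shift (suc e) = drop-shift e

    outside : ∀ a b → F a (b + suc d) + X (b + suc d) (k + suc d) ≡ X b k
    outside a b =
      cong₂ _+_ (F-zero a (b + suc d) (λ { (≤d , _) → <⇒≱ (m≤n+m (suc d) b) ≤d })) (shift-+ b _)

    inside : ∀ a b → a + b ≡ d → F (suc c + a) b + X b (k + suc d) ≡ X (suc c + a) k
    inside a b a+b≡d = F-term (suc c + a) b
      (trans (cong suc (trans (+-assoc c a b) (cong (c +_) a+b≡d))) (trans (sym (+-suc c d)) c+d≡r))
      (subst (b ≤_) a+b≡d (m≤n+m b a))

-- Littlewood-Richardson fillings of the staircase shape.

-- Records the row offsets and lengths that the enumeration guarantees but the type `Filling` does
-- not.
data OnStairs {k} (r : ℕ) : ℕ → Filling k → Set where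
  []  : OnStairs r zero []
  _∷_ : ∀ {n u t} → length u ≡ r → OnStairs r n t → OnStairs r (suc n) ((r * n , u) ∷ t)

length-words : ∀ k l {u} → u ∈ words k l → length u ≡ l
length-words k zero    (here refl) = refl
length-words k (suc l) u∈
  with _ , _ , _ , v∈ , refl ← ∈-cartesianProductWith⁻ _∷_ (allFin k) (words k l) u∈
  = cong suc (length-words k l v∈)

fillings-onStairs : ∀ k r n {t} → t ∈ fillings k (stairs r n) → OnStairs r n t
fillings-onStairs k r zero    (here refl) = []
fillings-onStairs k r (suc n) t∈
  with row , t′ , row∈ , t′∈ , refl ←
         ∈-cartesianProductWith⁻ _∷_ (map (r * n ,_) (words k (r * suc n ∸ r * n)))
           (fillings k (stairs r n)) t∈
  with u , u∈ , refl ← ∈-map⁻ (r * n ,_) row∈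
  = trans (length-words k _ u∈) (step-length r n) ∷ fillings-onStairs k r n t′∈

-- Each row ends where the row above it begins: aligning the columns drops all r entries of the
-- lower row, leaving no pair to compare.
onStairs-above : ∀ {k r n} {t : Filling k} → OnStairs r n t → Linked Above t
onStairs-above []       = []
onStairs-above (_ ∷ []) = [-]
onStairs-above {r = r} (_∷_ {u = u} _ (_∷_ {n} {v} |v|≡r t)) =
  subst (All _) (sym no-common-columns) [] ∷ onStairs-above (|v|≡r ∷ t)
  where
  no-common-columns : zip u (drop (r * suc n ∸ r * n) v) ≡ []
  no-common-columns = trans
    (cong (zip u) (drop-all _ v (≤-reflexive (trans |v|≡r (sym (step-length r n))))))
    (zipWith-zeroʳ _ u)

onStairs-length : ∀ {k r n} {t : Filling k} → OnStairs r n t → length (readingWord t) ≡ n * r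
onStairs-length []                        = refl
onStairs-length (_∷_ {u = u} |u|≡r t) = trans (length-++ (reverse u))
  (cong₂ _+_ (trans (length-reverse u) |u|≡r) (onStairs-length t))

-- Column strictness is automatic on this shape, and the number of 2's follows from the number of
-- 1's and the total length n r.
isLR⇔continues : ∀ r n ν₁ ν₂ ν₁≥ν₂ → ν₁ + ν₂ ≡ n * r → ∀ {t} → OnStairs r n t →
  IsLR (mkPartition (ν₁ ∷ ν₂ ∷ []) ν₁≥ν₂) t ⇔ Continues 0 ν₁ t
isLR⇔continues r n ν₁ ν₂ _ ν₁+ν₂≡nr {t} on = mk⇔
  (λ { ((weak , _) , content , ballot) →
    weak , Equivalence.to (ballot⇔ballotFrom w) ballot , content zero })
  (λ { (weak , ballot , ones) →
    (weak , onStairs-above on) ,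
    (λ { zero → ones ; (suc zero) → twos ones }) ,
    Equivalence.from (ballot⇔ballotFrom w) ballot })
  where
  w = readingWord t
  twos : count one w ≡ ν₁ → count two w ≡ ν₂
  twos ones = +-cancelˡ-≡ ν₁ _ _ (begin
    ν₁ + count two w           ≡⟨ cong (_+ count two w) ones ⟨
    count one w + count two w  ≡⟨ count-one+two w ⟩
    length w                   ≡⟨ onStairs-length on ⟩
    n * r                      ≡⟨ ν₁+ν₂≡nr ⟨
    ν₁ + ν₂                    ∎)

littlewoodRichardson-rows : ∀ ρ μ ν {rs} → skewRows ρ μ ≡ rs → Contained rs →
  littlewoodRichardson ρ μ ν ≡ tally (isLR? ν) (fillings (length (parts ν)) rs)
littlewoodRichardson-rows ρ μ ν refl μ⊆ρ rewrite dec-true (contained? (skewRows ρ μ)) μ⊆ρ = refl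

-- Exact halvings and the numerical hypotheses.

·-double : ∀ s m → s · (2 * m) ≡ twice s * m
·-double s m = trans (/-congˡ {o = 2} (regroup (twice s) m)) (m*n/n≡m (twice s * m) 2)
  where
  regroup : ∀ r m → r * (2 * m) ≡ r * m * 2
  regroup = solve-∀

fromℕ-· : ∀ k x → fromℕ k · x ≡ k * x
fromℕ-· k x = trans (/-congˡ {o = 2} (regroup k x)) (m*n/n≡m (k * x) 2)
  where
  regroup : ∀ k x → 2 * k * x ≡ k * x * 2
  regroup = solve-∀

skewRows-α : ∀ s n → skewRows (s ⋆ α (suc n)) (s ⋆ α n) ≡ stairs (twice s) (suc n)
-- The bottom row has no inner part; its default 0 has to be matched with r * 0.
skewRows-α s zero    = cong₂ (λ m l → (m , l) ∷ []) (sym (*-zeroʳ (twice s))) (·-double s 1)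
skewRows-α s (suc n) =
  cong₂ _∷_ (cong₂ _,_ (·-double s (suc n)) (·-double s (suc (suc n)))) (skewRows-α s n)

stairs-contained : ∀ r n → Contained (stairs r n)
stairs-contained r n = All.map⁺ (All.universal (λ i → *-monoʳ-≤ r (n≤1+n i)) (downFrom n))

-- First, the content s ⋆ (n + 1, n - 1) fills exactly the n r cells, which fails if halving rounds
-- down; second, the hypothesis of `continuations-formula` at d = 0, k = s(n + 1).
Balanced : ℕ → HalfInteger → Set
Balanced n s = s · (n + 1) + s · (n ∸ 1) ≡ n * twice s × n * twice s ≤ s · (n + 1) + s · (n + 1)

littlewoodRichardson-formula : ∀ n s → Balanced (suc n) s →
  littlewoodRichardson (s ⋆ α (suc n)) (s ⋆ α n) (s ⋆ β (suc n))
    + binomial (twice s) (suc n) (s · (suc n + 1) + 1)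
  ≡ binomial (twice s) (suc n) (s · (suc n + 1))
littlewoodRichardson-formula n s (total , excess) = begin
  littlewoodRichardson (s ⋆ α (suc n)) (s ⋆ α n) ν + _
    ≡⟨ cong (_+ binomial r (suc n) (k + 1))
         (littlewoodRichardson-rows (s ⋆ α (suc n)) (s ⋆ α n) ν
           (skewRows-α s n) (stairs-contained r (suc n))) ⟩
  tally (isLR? ν) (fillings 2 (stairs r (suc n))) + _
    ≡⟨ cong (_+ binomial r (suc n) (k + 1))
         (tally-cong (isLR? ν) (continues? 0 k) (fillings 2 (stairs r (suc n)))
           (isLR⇔continues r (suc n) _ _ (decreasing ν) total ∘ fillings-onStairs 2 r (suc n))) ⟩
  continuations r (suc n) 0 k + binomial r (suc n) (k + 1)
    ≡⟨ continuations-formula r (suc n) 0 k excess ⟩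
  binomial r (suc n) k ∎
  where
  ν = s ⋆ β (suc n)
  r = twice s
  k = s · (suc n + 1)

balanced-fromℕ : ∀ n k → Balanced (suc n) (fromℕ k)
balanced-fromℕ n k rewrite fromℕ-· k (suc n + 1) | fromℕ-· k n =
  -- The slack is 2s(n + 1) - 2sn = 2s, here 2k.
  total n k , ≤-trans (m≤m+n _ (2 * k)) (≤-reflexive (excess n k))
  where
  total : ∀ n k → k * (suc n + 1) + k * n ≡ suc n * (2 * k)
  total = solve-∀
  excess : ∀ n k → suc n * (2 * k) + 2 * k ≡ k * (suc n + 1) + k * (suc n + 1)
  excess = solve-∀

1+2m+1≡2[1+m] : ∀ m → suc (2 * m) + 1 ≡ 2 * suc m
1+2m+1≡2[1+m] = solve-∀

-- For n = 2m + 1 both n + 1 and n - 1 are even, so the halvings in s(n + 1) and s(n - 1) are exact.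
balanced-odd : ∀ m s → Balanced (suc (2 * m)) s
balanced-odd m s
  rewrite trans (cong (s ·_) (1+2m+1≡2[1+m] m)) (·-double s (suc m)) | ·-double s m =
  total m (twice s) , ≤-trans (m≤m+n _ (twice s)) (≤-reflexive (excess m (twice s)))
  where
  total : ∀ m r → r * suc m + r * m ≡ suc (2 * m) * r
  total = solve-∀
  excess : ∀ m r → suc (2 * m) * r + r ≡ r * suc m + r * suc m
  excess = solve-∀

balanced : ∀ n s →
  (0 < n × (∃[ k ] 0 < k × s ≡ fromℕ k)) ⊎ ((∃[ k ] Odd k × s ≡ k /2) × Odd n) →
  ∃[ m ] n ≡ suc m × Balanced n s
balanced (suc n) s (inj₁ (_ , k , _ , refl)) = n , refl , balanced-fromℕ n k
balanced n       s (inj₂ (_ , m , refl))     = 2 * m , refl , balanced-odd m s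

-- From the additive identity in ℕ to a difference in ℤ.

open import Data.Integer.Base using (+_; _-_; _⊖_)
import Data.Integer.Properties as ℤ

+-difference : ∀ {x y z} → x + y ≡ z → + x ≡ + z - + y
+-difference {x} {y} refl = begin
  + x            ≡⟨ cong +_ (m+n∸n≡m x y) ⟨
  + (x + y ∸ y)  ≡⟨ ℤ.⊖-≥ (m≤n+m y x) ⟨
  x + y ⊖ y      ≡⟨ ℤ.m-n≡m⊖n (x + y) y ⟨
  + (x + y) - + y ∎

theorem3 : (n : ℕ) (s : HalfInteger) →
    (0 < n × (∃[ k ] 0 < k × s ≡ fromℕ k)) ⊎ ((∃[ k ] Odd k × s ≡ k /2) × Odd n) →
    + littlewoodRichardson (s ⋆ α n) (s ⋆ α (n ∸ 1)) (s ⋆ β n)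
    ≡ + binomial (twice s) n (s · (n + 1)) - + binomial (twice s) n (s · (n + 1) + 1)
theorem3 n s h with balanced n s h
... | n′ , refl , bal = +-difference (littlewoodRichardson-formula n′ s bal)
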